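{- Let $n=p_1^{n_1}p_2^{n_2}\cdots p_r^{n_r}$, where $r\geq 3$, $n_1,\ldots,n_r$ are positive integers and $p_1<p_2<\cdots<p_r$ are prime numbers. Then $\kappa(\mathcal{P}(C_n))\leq \gamma(n)$, where $$\gamma(n)= \phi(n)+\frac{n}{p_1\cdots p_r}\left[\phi(p_1\cdots p_{r-1})+ \phi(p_1\cdots p_{r-2}p_r)+p_1\cdots p_{r-2}-\phi(p_1\cdots p_{r-2})\right].$$
   Context: $C_n$ is the cyclic group of order $n$ and $\phi$ is Euler's totient function. The power graph $\mathcal{P}(G)$ of a finite group $G$ is the simple undirected graph with vertex set $G$ in which two distinct vertices $x,y$ are adjacent if and only if $x\in\langle y\rangle$ or $y\in\langle x\rangle$. The vertex connectivity $\kappa(\Gamma)$ of a graph $\Gamma$ is the minimum number of vertices which need to be removed so that the induced subgraph on the remaining vertices is disconnected or has only one vertex. -}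

module Defs where

open import Algebra.Bundles using (Group)
open import Algebra.Core using (Op₁; Op₂)
open import Algebra.Structures using (IsGroup)
import Algebra.Properties.Group as GroupProperties
import Algebra.Properties.Monoid.Mult as Mult
open import Data.Empty using (⊥-elim)
open import Data.Fin using (Fin; zero; suc; toℕ; fromℕ<)
open import Data.Fin.Properties
  using (toℕ<n; toℕ-fromℕ<; toℕ-injective; pigeonhole; any?)
  renaming (_≟_ to _≟ᶠ_)
open import Data.Fin.Subset using (Subset; _∉_; ∁; ∣_∣; ⁅_⁆)
open import Data.Fin.Subset.Properties
  using (_∈?_; anySubset?; ∣∁p∣≡n∸∣p∣; ∣p∣≤n; ∣⁅x⁆∣≡1)
open import Data.Integer using (ℤ; +_; -[1+_])
open import Data.List using (length; filter; map; upTo)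
open import Data.Nat
open import Data.Nat.Coprimality using (coprime?)
open import Data.Nat.DivMod
open import Data.Nat.Primality using (Prime; prime⇒nonZero)
open import Data.Nat.Properties
open import Data.Product using (∃; ∃-syntax; ∃₂; _,_; proj₁; proj₂; _×_)
open import Data.Sum using (_⊎_; inj₁; inj₂; swap)
open import Level using (0ℓ)
open import Function using (_∘_)
open import Relation.Binary using (Rel; Symmetric; Irreflexive; Decidable)
open import Relation.Binary.Construct.Closure.ReflexiveTransitive
  using (Star; _◅_; _◅◅_) renaming (ε to [])
open import Relation.Binary.PropositionalEquality
open import Relation.Nullary using (Dec; yes; no; ¬_)
open import Relation.Nullary.Decidable
  using (map′; ¬?; _×-dec_; _⊎-dec_)

-- The elements are labelled by Fin n, so equality is propositional.
record FiniteGroup (n : ℕ) : Set where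
  infixl 7 _∙_
  field
    _∙_     : Op₂ (Fin n)
    ε       : Fin n
    _⁻¹     : Op₁ (Fin n)
    isGroup : IsGroup _≡_ _∙_ ε _⁻¹

  group : Group 0ℓ 0ℓ
  group = record { isGroup = isGroup }

  open Group group public using (monoid; assoc; identityˡ; identityʳ)
  open GroupProperties group using (inverseʳ-unique; ∙-cancelˡ)
  open Mult monoid public using ()
    renaming ( _×_ to _·_; ×-homo-+ to ·-homo-+; ×-assocˡ to ·-assocˡ)

  infixr 8 _^ᶻ_
  _^ᶻ_ : Fin n → ℤ → Fin n
  x ^ᶻ (+ k)    = k · x
  x ^ᶻ -[1+ k ] = (suc k · x) ⁻¹

  infix 4 _∈⟨_⟩
  _∈⟨_⟩ : Fin n → Fin n → Set
  x ∈⟨ y ⟩ = ∃[ k ] x ≡ y ^ᶻ k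

  private
    ·-ε : ∀ k → k · ε ≡ ε
    ·-ε zero    = refl
    ·-ε (suc k) = trans (identityˡ _) (·-ε k)

    period : ∀ y → ∃[ d ] (suc d ≤ n × suc d · y ≡ ε)
    period y with i , j , i<j , eq ← pigeonhole (n<1+n n) (λ (i : Fin (suc n)) → toℕ i · y)
             = toℕ j ∸ suc (toℕ i)
             , ≤-trans (≤-reflexive shift)
                 (≤-trans (m∸n≤m (toℕ j) (toℕ i)) (s≤s⁻¹ (toℕ<n j)))
             , ∙-cancelˡ (toℕ i · y) _ _ (begin
                 toℕ i · y ∙ suc (toℕ j ∸ suc (toℕ i)) · y
                   ≡⟨ cong (λ z → toℕ i · y ∙ z · y) shift ⟩
                 toℕ i · y ∙ (toℕ j ∸ toℕ i) · y
                   ≡⟨ ·-homo-+ y (toℕ i) (toℕ j ∸ toℕ i) ⟨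
                 (toℕ i + (toℕ j ∸ toℕ i)) · y
                   ≡⟨ cong (_· y) (m+[n∸m]≡n (<⇒≤ i<j)) ⟩
                 toℕ j · y
                   ≡⟨ eq ⟨
                 toℕ i · y
                   ≡⟨ identityʳ _ ⟨
                 toℕ i · y ∙ ε ∎)
      where
      open ≡-Reasoning
      shift : suc (toℕ j ∸ suc (toℕ i)) ≡ toℕ j ∸ toℕ i
      shift = sym (+-∸-assoc 1 i<j)

    reduce : ∀ y k → ∃[ i ] (k · y ≡ toℕ {n} i · y)
    reduce y k with d , d<n , dy≡ε ← period y
      = fromℕ< r<n , (begin
          k · y
            ≡⟨ cong (_· y) (m≡m%n+[m/n]*n k (suc d)) ⟩
          (k % suc d + (k / suc d) * suc d) · y
            ≡⟨ ·-homo-+ y (k % suc d) _ ⟩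
          (k % suc d) · y ∙ ((k / suc d) * suc d) · y
            ≡⟨ cong ((k % suc d) · y ∙_) (sym (·-assocˡ y (k / suc d) (suc d))) ⟩
          (k % suc d) · y ∙ (k / suc d) · (suc d · y)
            ≡⟨ cong (λ z → (k % suc d) · y ∙ (k / suc d) · z) dy≡ε ⟩
          (k % suc d) · y ∙ (k / suc d) · ε
            ≡⟨ cong ((k % suc d) · y ∙_) (·-ε (k / suc d)) ⟩
          (k % suc d) · y ∙ ε
            ≡⟨ identityʳ _ ⟩
          (k % suc d) · y
            ≡⟨ cong (_· y) (toℕ-fromℕ< r<n) ⟨
          toℕ (fromℕ< r<n) · y ∎)
      where
      open ≡-Reasoning
      r<n : k % suc d < n
      r<n = <-≤-trans (m%n<n k (suc d)) d<n

    natural : ∀ y k → ∃[ m ] (y ^ᶻ k ≡ m · y)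
    natural y (+ k)    = k , refl
    natural y -[1+ k ] with d , _ , dy≡ε ← period y
      = d * suc k , sym (inverseʳ-unique (suc k · y) ((d * suc k) · y) (begin
          suc k · y ∙ (d * suc k) · y  ≡⟨ ·-homo-+ y (suc k) (d * suc k) ⟨
          (suc d * suc k) · y          ≡⟨ cong (_· y) (*-comm (suc d) (suc k)) ⟩
          (suc k * suc d) · y          ≡⟨ ·-assocˡ y (suc k) (suc d) ⟨
          suc k · (suc d · y)          ≡⟨ cong (suc k ·_) dy≡ε ⟩
          suc k · ε                    ≡⟨ ·-ε (suc k) ⟩
          ε ∎))
      where open ≡-Reasoning

  infix 4 _∈⟨_⟩?
  _∈⟨_⟩? : Decidable _∈⟨_⟩
  x ∈⟨ y ⟩? = map′ (λ (i , eq) → + toℕ i , eq) to (any? (λ i → x ≟ᶠ toℕ i · y))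
    where
    to : x ∈⟨ y ⟩ → ∃[ i ] x ≡ toℕ {n} i · y
    to (k , eq) with m , eq₁ ← natural y k | i , eq₂ ← reduce y (proj₁ (natural y k))
      = i , trans eq (trans eq₁ eq₂)

module _ (n : ℕ) .{{_ : NonZero n}} where

  private
    _⊕_ : Op₂ (Fin n)
    x ⊕ y = (toℕ x + toℕ y) mod n

    0ᶠ : Fin n
    0ᶠ = 0 mod n

    ⊖_ : Op₁ (Fin n)
    ⊖ x = (n ∸ toℕ x) mod n

    toℕ-mod : ∀ a → toℕ (a mod n) ≡ a % n
    toℕ-mod a = toℕ-fromℕ< (m%n<n a n)

    mod-toℕ : ∀ (x : Fin n) → toℕ x mod n ≡ x
    mod-toℕ x = toℕ-injective (trans (toℕ-mod _) (m<n⇒m%n≡m (toℕ<n x)))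

    mod-cong : ∀ {a b} → a % n ≡ b % n → a mod n ≡ b mod n
    mod-cong eq = toℕ-injective (trans (toℕ-mod _) (trans eq (sym (toℕ-mod _))))

    %-absorbˡ : ∀ a b → (a % n + b) % n ≡ (a + b) % n
    %-absorbˡ a b = begin
      (a % n + b) % n          ≡⟨ %-distribˡ-+ (a % n) b n ⟩
      (a % n % n + b % n) % n  ≡⟨ cong (λ z → (z + b % n) % n) (m%n%n≡m%n a n) ⟩
      (a % n + b % n) % n      ≡⟨ %-distribˡ-+ a b n ⟨
      (a + b) % n              ∎
      where open ≡-Reasoning

    ⊕-comm : ∀ x y → x ⊕ y ≡ y ⊕ x
    ⊕-comm x y = cong (_mod n) (+-comm (toℕ x) (toℕ y))

    mod-⊕ : ∀ a y → (a mod n) ⊕ y ≡ (a + toℕ y) mod n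
    mod-⊕ a y = mod-cong (trans (cong (λ z → (z + toℕ y) % n) (toℕ-mod a))
                                (%-absorbˡ a (toℕ y)))

    ⊕-mod : ∀ x b → x ⊕ (b mod n) ≡ (toℕ x + b) mod n
    ⊕-mod x b = trans (⊕-comm x _) (trans (mod-⊕ b x) (cong (_mod n) (+-comm b (toℕ x))))

    ⊕-assoc : ∀ x y z → (x ⊕ y) ⊕ z ≡ x ⊕ (y ⊕ z)
    ⊕-assoc x y z = trans (mod-⊕ _ z)
      (trans (cong (_mod n) (+-assoc (toℕ x) (toℕ y) (toℕ z))) (sym (⊕-mod x _)))

    ⊕-identityˡ : ∀ x → 0ᶠ ⊕ x ≡ x
    ⊕-identityˡ x = trans (mod-⊕ 0 x) (mod-toℕ x)

    ⊕-inverseˡ : ∀ x → (⊖ x) ⊕ x ≡ 0ᶠ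
    ⊕-inverseˡ x = trans (mod-⊕ _ x) (trans
      (cong (_mod n) (m∸n+n≡m (<⇒≤ (toℕ<n x))))
      (mod-cong ([m+n]%n≡m%n 0 n)))

  C : FiniteGroup n
  C = record
    { _∙_ = _⊕_
    ; ε   = 0ᶠ
    ; _⁻¹ = ⊖_
    ; isGroup = record
      { isMonoid = record
        { isSemigroup = record
          { isMagma = record { isEquivalence = isEquivalence ; ∙-cong = cong₂ _⊕_ }
          ; assoc = ⊕-assoc }
        ; identity = ⊕-identityˡ , λ x → trans (⊕-comm x _) (⊕-identityˡ x) }
      ; inverse = ⊕-inverseˡ , λ x → trans (⊕-comm x _) (⊕-inverseˡ x)
      ; ⁻¹-cong = cong ⊖_ } }

record SimpleGraph (n : ℕ) : Set₁ where
  field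
    Adj        : Rel (Fin n) 0ℓ
    adj-sym    : Symmetric Adj
    adj-irrefl : Irreflexive _≡_ Adj
    adj?       : Decidable Adj

module _ {n : ℕ} (G : FiniteGroup n) where
  open FiniteGroup G

  𝒫 : SimpleGraph n
  𝒫 = record
    { Adj        = λ x y → x ≢ y × (x ∈⟨ y ⟩ ⊎ y ∈⟨ x ⟩)
    ; adj-sym    = λ (x≢y , h) → x≢y ∘ sym , swap h
    ; adj-irrefl = λ x≡y (x≢y , _) → x≢y x≡y
    ; adj?       = λ x y → ¬? (x ≟ᶠ y) ×-dec (x ∈⟨ y ⟩? ⊎-dec y ∈⟨ x ⟩?)
    }

-- Warshall's algorithm.
private
  module Reachability {n : ℕ} {R : Rel (Fin n) 0ℓ} (R? : Decidable R) where

    -- Via k _ u v: a walk from u to v whose inner vertices are all below k.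
    Via : ∀ k → k ≤ n → Rel (Fin n) 0ℓ
    Via zero    _   u v = u ≡ v ⊎ R u v
    Via (suc k) k<n u v = Via k (<⇒≤ k<n) u v
      ⊎ (Via k (<⇒≤ k<n) u (fromℕ< k<n) × Via k (<⇒≤ k<n) (fromℕ< k<n) v)

    via? : ∀ k k≤n → Decidable (Via k k≤n)
    via? zero    _   u v = (u ≟ᶠ v) ⊎-dec R? u v
    via? (suc k) k<n u v = via? k _ u v ⊎-dec (via? k _ u _ ×-dec via? k _ _ v)

    sound : ∀ k k≤n {u v} → Via k k≤n u v → Star R u v
    sound zero    _   (inj₁ refl)    = []
    sound zero    _   (inj₂ r)       = r ◅ []
    sound (suc k) k<n (inj₁ h)       = sound k _ h
    sound (suc k) k<n (inj₂ (g , h)) = sound k _ g ◅◅ sound k _ h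

    base : ∀ k k≤n {u v} → u ≡ v ⊎ R u v → Via k k≤n u v
    base zero    _   h = h
    base (suc k) k<n h = inj₁ (base k _ h)

    to-mid : ∀ k (k<n : k < n) {u} → Via (suc k) k<n u (fromℕ< k<n) →
             Via k (<⇒≤ k<n) u (fromℕ< k<n)
    to-mid k k<n (inj₁ h)       = h
    to-mid k k<n (inj₂ (h , _)) = h

    from-mid : ∀ k (k<n : k < n) {v} → Via (suc k) k<n (fromℕ< k<n) v →
               Via k (<⇒≤ k<n) (fromℕ< k<n) v
    from-mid k k<n (inj₁ h)       = h
    from-mid k k<n (inj₂ (_ , h)) = h

    join : ∀ k k≤n {u w v} → toℕ w < k → Via k k≤n u w → Via k k≤n w v → Via k k≤n u v
    join (suc k) k<n {u} {w} {v} w<1+k g h with m≤n⇒m<n∨m≡n (s≤s⁻¹ w<1+k)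
    ... | inj₂ w≡k with refl ← toℕ-injective {j = fromℕ< k<n} (trans w≡k (sym (toℕ-fromℕ< k<n)))
      = inj₂ (to-mid k k<n g , from-mid k k<n h)
    ... | inj₁ w<k with g | h
    ...   | inj₁ g′        | inj₁ h′        = inj₁ (join k _ w<k g′ h′)
    ...   | inj₁ g′        | inj₂ (h₁ , h₂) = inj₂ (join k _ w<k g′ h₁ , h₂)
    ...   | inj₂ (g₁ , g₂) | inj₁ h′        = inj₂ (g₁ , join k _ w<k g₂ h′)
    ...   | inj₂ (g₁ , _)  | inj₂ (_ , h₂)  = inj₂ (g₁ , h₂)

    complete : ∀ {u v} → Star R u v → Via n ≤-refl u v
    complete []       = base n ≤-refl (inj₁ refl)
    complete (r ◅ rs) = join n ≤-refl (toℕ<n _) (base n ≤-refl (inj₂ r)) (complete rs)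

    star? : Decidable (Star R)
    star? u v = map′ (sound n ≤-refl) complete (via? n ≤-refl u v)

module _ {n : ℕ} (Γ : SimpleGraph n) where
  open SimpleGraph Γ

  -- The subgraph induced on the complement of S is kept on Fin n: a subtype
  -- pairing a vertex with its proof of _∉_ would have duplicate vertices.
  AdjOff : Subset n → Rel (Fin n) 0ℓ
  AdjOff S u v = u ∉ S × v ∉ S × Adj u v

  DisconnectedOff : Subset n → Set
  DisconnectedOff S = ∃₂ λ u v → u ∉ S × v ∉ S × ¬ Star (AdjOff S) u v

  Separating : Subset n → Set
  Separating S = DisconnectedOff S ⊎ ∣ ∁ S ∣ ≡ 1

  IsVertexConnectivity : ℕ → Set
  IsVertexConnectivity k =
    (∃[ S ] (Separating S × ∣ S ∣ ≡ k)) × (∀ S → Separating S → k ≤ ∣ S ∣)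

  private
    separating? : ∀ S → Dec (Separating S)
    separating? S =
      any? (λ u → any? λ v → ¬? (u ∈? S) ×-dec ¬? (v ∈? S) ×-dec ¬? (star? u v))
        ⊎-dec (∣ ∁ S ∣ ≟ 1)
      where
      adjOff? : Decidable (AdjOff S)
      adjOff? u v = ¬? (u ∈? S) ×-dec ¬? (v ∈? S) ×-dec adj? u v
      open Reachability adjOff?

    CutOfSize : ℕ → Set
    CutOfSize k = ∃[ S ] (Separating S × ∣ S ∣ ≡ k)

    search : ∀ f k → (∀ S → Separating S → k ≤ ∣ S ∣) → CutOfSize (f + k) →
             ∃ IsVertexConnectivity
    search zero    k low cut = k , cut , low
    search (suc f) k low cut
      with anySubset? (λ S → separating? S ×-dec (∣ S ∣ ≟ k))
    ... | yes found = k , found , low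
    ... | no  none  = search f (suc k)
            (λ S sep → ≤∧≢⇒< (low S sep) (λ k≡ → none (S , sep , sym k≡)))
            (subst CutOfSize (sym (+-suc f k)) cut)

  -- The empty graph is excluded: nothing can be removed to leave one vertex.
  vertexConnectivity : .{{_ : NonZero n}} → ∃ IsVertexConnectivity
  vertexConnectivity = search ∣ S₀ ∣ 0 (λ _ _ → z≤n)
      (S₀ , inj₂ single , sym (+-identityʳ _))
    where
    v₀ : Fin n
    v₀ = 0 mod n
    S₀ : Subset n
    S₀ = ∁ ⁅ v₀ ⁆
    single : ∣ ∁ S₀ ∣ ≡ 1
    single = begin
      ∣ ∁ S₀ ∣               ≡⟨ ∣∁p∣≡n∸∣p∣ S₀ ⟩
      n ∸ ∣ ∁ ⁅ v₀ ⁆ ∣       ≡⟨ cong (n ∸_) (∣∁p∣≡n∸∣p∣ ⁅ v₀ ⁆) ⟩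
      n ∸ (n ∸ ∣ ⁅ v₀ ⁆ ∣)   ≡⟨ m∸[m∸n]≡n (∣p∣≤n ⁅ v₀ ⁆) ⟩
      ∣ ⁅ v₀ ⁆ ∣             ≡⟨ ∣⁅x⁆∣≡1 v₀ ⟩
      1                      ∎
      where open ≡-Reasoning

  κ : .{{_ : NonZero n}} → ℕ
  κ = proj₁ vertexConnectivity

φ : ℕ → ℕ
φ n = length (filter (λ k → coprime? k n) (map suc (upTo n)))

-- ∏ k f = f 1 * f 2 * ⋯ * f k
∏ : ℕ → (ℕ → ℕ) → ℕ
∏ zero    f = 1
∏ (suc k) f = ∏ k f * f (suc k)

-- n = p 1 ^ e 1 * ⋯ * p r ^ e r; values of p and e outside 1, …, r are irrelevant.
record PrimePowerFactorisation (n : ℕ) : Set where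
  field
    r          : ℕ
    p e        : ℕ → ℕ
    p-prime    : ∀ i → 1 ≤ i → i ≤ r → Prime (p i)
    p-strict   : ∀ i j → 1 ≤ i → i < j → j ≤ r → p i < p j
    e-positive : ∀ i → 1 ≤ i → i ≤ r → 1 ≤ e i
    n≡∏p^e     : n ≡ ∏ r (λ i → p i ^ e i)

  ∏p-nonZero : NonZero (∏ r p)
  ∏p-nonZero = go r ≤-refl
    where
    go : ∀ k → k ≤ r → NonZero (∏ k p)
    go zero    _   = _
    go (suc k) k<r = m*n≢0 (∏ k p) (p (suc k))
      {{go k (<⇒≤ k<r)}} {{prime⇒nonZero (p-prime (suc k) (s≤s z≤n) k<r)}}

  -- Both the division and the subtraction are exact: ∏ r p divides n and φ m ≤ m.
  -- Indices are meaningful for r ≥ 3.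
  γ : ℕ
  γ = φ n + _/_ n (∏ r p) {{∏p-nonZero}} *
        ( φ (∏ (r ∸ 1) p)
        + φ (∏ (r ∸ 2) p * p r)
        + (∏ (r ∸ 2) p ∸ φ (∏ (r ∸ 2) p)) )

{-# OPTIONS --safe #-}
module Submission where

-- In ℤ/n let P and Q be the two largest primes dividing n, D the product of the
-- others, and B the set of those x divisible by PQ and coprime to D.  Since
-- x ∈ ⟨ y ⟩ makes every common divisor of y and n divide x, a neighbour y of
-- x ∈ B is coprime to D or divisible by PQ.  Deleting all such y outside B
-- therefore cuts B off from the residue of D.  The deleted y are of four kinds,
-- counted by the four terms of γ: coprime to n; divisible by Q and coprime to DP;
-- divisible by P and coprime to DQ; divisible by PQ and not coprime to D.

open import Defs
open import Data.Bool using (if_then_else_)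
open import Data.Empty using (⊥-elim)
open import Data.Fin using (Fin; toℕ)
open import Data.Fin.Properties using (toℕ<n; toℕ-fromℕ<)
open import Data.Fin.Subset using (Subset; _∈_; _∉_) renaming (∣_∣ to size)
import Data.Integer as ℤ
open import Data.List using (length; filter; map; upTo; applyUpTo)
open import Data.List.Properties using (map-upTo)
open import Data.Nat
open import Data.Nat.Coprimality using (Coprime; coprime?; coprime-divisor; coprime-+)
  renaming (sym to coprime-sym)
open import Data.Nat.DivMod
open import Data.Nat.Divisibility
open import Data.Nat.Primality
  using (Prime; prime⇒nonZero; prime⇒nonTrivial; prime⇒irreducible)
open import Data.Nat.Properties
open import Data.Nat.Tactic.RingSolver using (solve-∀)
open import Data.Product using (_,_; proj₁; proj₂; _×_)
open import Data.Sum using (_⊎_; inj₁; inj₂; [_,_]′)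
open import Data.Vec using (tabulate)
open import Data.Vec.Properties using (lookup∘tabulate; []=⇒lookup; lookup⇒[]=)
open import Function using (id; _∘_; _$_)
open import Level using (0ℓ)
open import Relation.Binary.Construct.Closure.ReflexiveTransitive
  using (Star; _◅_) renaming (ε to [])
open import Relation.Binary.PropositionalEquality
open import Relation.Nullary using (Dec; yes; no; ¬_; does; contradiction)
open import Relation.Nullary.Decidable using (¬?; _×-dec_; _⊎-dec_; dec-true)
open import Relation.Unary using (Pred; Decidable)

-- Counting the naturals below a bound that satisfy a predicate.

private
  variable
    U V : Pred ℕ 0ℓ
    a b d m n : ℕ

-- The recursion splits off 0 and shifts the predicate, as `applyUpTo` and `tabulate` do, so the
-- conversions to list lengths and subset sizes are plain inductions.
count : Decidable U → ℕ → ℕ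
count U? zero    = 0
count U? (suc n) = if does (U? 0) then suc else id $ count (U? ∘ suc) n

count-mono : (U? : Decidable U) (V? : Decidable V) → ∀ n →
             (∀ x → x < n → U x → V x) → count U? n ≤ count V? n
count-mono U? V? zero    U⇒V = z≤n
count-mono U? V? (suc n) U⇒V
  with U? 0 | V? 0 | count-mono (U? ∘ suc) (V? ∘ suc) n (λ x x<n → U⇒V (suc x) (s≤s x<n))
... | yes p | yes _ | ih = s≤s ih
... | yes p | no ¬q | _  = contradiction (U⇒V 0 z<s p) ¬q
... | no _  | yes _ | ih = m≤n⇒m≤1+n ih
... | no _  | no _  | ih = ih

count-cong : (U? : Decidable U) (V? : Decidable V) → ∀ n →
             (∀ x → U x → V x) → (∀ x → V x → U x) → count U? n ≡ count V? n
count-cong U? V? n U⇒V V⇒U = ≤-antisym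
  (count-mono U? V? n (λ x _ → U⇒V x)) (count-mono V? U? n (λ x _ → V⇒U x))

count-+ : (U? : Decidable U) → ∀ a b →
          count U? (a + b) ≡ count U? a + count (U? ∘ (a +_)) b
count-+ U? zero    b = refl
count-+ U? (suc a) b with U? 0 | count-+ (U? ∘ suc) a b
... | yes _ | ih = cong suc ih
... | no _  | ih = ih

count-none : (U? : Decidable U) → ∀ n → (∀ x → x < n → ¬ U x) → count U? n ≡ 0
count-none U? zero    none = refl
count-none U? (suc n) none
  with U? 0 | count-none (U? ∘ suc) n (λ x x<n → none (suc x) (s≤s x<n))
... | yes p | _  = contradiction p (none 0 z<s)
... | no _  | ih = ih

count-⊎ : (U? : Decidable U) (V? : Decidable V) → ∀ n →
          count (λ x → U? x ⊎-dec V? x) n ≤ count U? n + count V? n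
count-⊎ U? V? zero    = z≤n
count-⊎ U? V? (suc n) with U? 0 | V? 0 | count-⊎ (U? ∘ suc) (V? ∘ suc) n
... | yes _ | yes _ | ih = s≤s (≤-trans ih (+-monoʳ-≤ _ (n≤1+n _)))
... | yes _ | no _  | ih = s≤s ih
... | no _  | yes _ | ih = ≤-trans (s≤s ih) (≤-reflexive (sym (+-suc _ _)))
... | no _  | no _  | ih = ih

count-¬ : (U? : Decidable U) → ∀ n → count (¬? ∘ U?) n ≡ n ∸ count U? n
count-¬ U? n = sym (trans (cong (_∸ count U? n) (sym (total U? n)))
                          (m+n∸m≡n (count U? n) _))
  where
  total : ∀ {U} (U? : Decidable U) n → count U? n + count (¬? ∘ U?) n ≡ n
  total U? zero    = refl
  total U? (suc n) with U? 0 | total (U? ∘ suc) n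
  ... | yes _ | ih = cong suc ih
  ... | no _  | ih = trans (+-suc _ _) (cong suc ih)

-- Cut the range into `k` blocks of length `m`. Shifting a block back by `m` keeps every hit, so no
-- block has more hits than the first.
count-periodic : (U? : Decidable U) → ∀ m → (∀ x → U (m + x) → U x) → ∀ k →
                 count U? (k * m) ≤ k * count U? m
count-periodic U? m period zero    = z≤n
count-periodic U? m period (suc k) = begin
  count U? (m + k * m)
    ≡⟨ count-+ U? m (k * m) ⟩
  count U? m + count (U? ∘ (m +_)) (k * m)
    ≤⟨ +-monoʳ-≤ _ (count-mono _ U? (k * m) (λ x _ → period x)) ⟩
  count U? m + count U? (k * m)
    ≤⟨ +-monoʳ-≤ _ (count-periodic U? m period k) ⟩
  count U? m + k * count U? m ∎
  where open ≤-Reasoning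

-- Cut the range into `m` blocks of length `d`. Only the first number of a block is a multiple of
-- `d`, and in block `y` that number is `y * d`.
count-multiples : ∀ d .{{_ : NonZero d}} (U? : Decidable U) → ∀ m →
                  count (λ x → (d ∣? x) ×-dec U? x) (m * d) ≤ count (λ y → U? (y * d)) m
count-multiples d          U? zero    = z≤n
count-multiples d@(suc d′) U? (suc m) = begin
  count D? (d + m * d)
    ≡⟨ count-+ D? d (m * d) ⟩
  count D? d + count (D? ∘ (d +_)) (m * d)
    ≤⟨ +-mono-≤ first (≤-trans (count-mono _ _ (m * d) shift)
                               (count-multiples d (U? ∘ (d +_)) m)) ⟩
  count U?′ 1 + count (U?′ ∘ suc) m
    ≡⟨ count-+ U?′ 1 m ⟨
  count U?′ (suc m) ∎
  where
  open ≤-Reasoning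
  D?  = λ x → (d ∣? x) ×-dec U? x
  U?′ = λ y → U? (y * d)
  -- Removing the first block replaces `U` by its translate by `d`; divisibility by `d` is
  -- unchanged.
  shift = λ x _ (d∣d+x , p) → ∣m+n∣m⇒∣n {d} d∣d+x ∣-refl , p
  first : count D? d ≤ count U?′ 1
  first = begin
    count D? (1 + d′)
      ≡⟨ count-+ D? 1 d′ ⟩
    count D? 1 + count (D? ∘ suc) d′
      -- The rest of the first block is 1, ..., `d′`: positive numbers below `d`, hence no multiples
      -- of `d`.
      ≡⟨ cong (count D? 1 +_) (count-none (D? ∘ suc) d′
           λ x x<d′ (d∣1+x , _) → <⇒≱ x<d′ (s≤s⁻¹ (∣⇒≤ d∣1+x))) ⟩
    count D? 1 + 0
      ≡⟨ +-identityʳ _ ⟩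
    count D? 1
      ≤⟨ count-mono D? U?′ 1 (λ { zero _ (_ , p) → p ; (suc _) (s≤s ()) _ }) ⟩
    count U?′ 1 ∎

-- Counts as list lengths and as sizes of subsets.

length-filter-applyUpTo : (U? : Decidable U) (f : ℕ → ℕ) → ∀ n →
                          length (filter U? (applyUpTo f n)) ≡ count (U? ∘ f) n
length-filter-applyUpTo U? f zero    = refl
length-filter-applyUpTo U? f (suc n)
  with U? (f 0) | length-filter-applyUpTo U? (f ∘ suc) n
... | yes _ | ih = cong suc ih
... | no _  | ih = ih

filterᶠ : Decidable U → ∀ n → Subset n
filterᶠ U? n = tabulate (λ i → does (U? (toℕ i)))

size-filterᶠ : (U? : Decidable U) → ∀ n → size (filterᶠ U? n) ≡ count U? n
size-filterᶠ U? zero    = refl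
size-filterᶠ U? (suc n) with U? 0 | size-filterᶠ (U? ∘ suc) n
... | yes _ | ih = cong suc ih
... | no _  | ih = ih

∈-filterᶠ⁺ : (U? : Decidable U) → ∀ {x : Fin n} → U (toℕ x) → x ∈ filterᶠ U? n
∈-filterᶠ⁺ U? {x} u =
  lookup⇒[]= x _ (trans (lookup∘tabulate _ x) (dec-true (U? (toℕ x)) u))

∈-filterᶠ⁻ : (U? : Decidable U) → ∀ {x : Fin n} → x ∈ filterᶠ U? n → U (toℕ x)
∈-filterᶠ⁻ U? {x} x∈ with U? (toℕ x) | trans (sym (lookup∘tabulate _ x)) ([]=⇒lookup x∈)
... | yes u | _  = u
... | no _  | ()

-- Coprimality.

coprime-∣ : a ∣ m → b ∣ n → Coprime m n → Coprime a b
coprime-∣ a∣m b∣n m⊥n (d∣a , d∣b) = m⊥n (∣-trans d∣a a∣m , ∣-trans d∣b b∣n)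

-- A divisor of `m` inherits coprimality to `a`, so if it divides `a * b` it already divides `b`.
coprime-*ʳ : Coprime m a → Coprime m b → Coprime m (a * b)
coprime-*ʳ m⊥a m⊥b (d∣m , d∣ab) =
  m⊥b (d∣m , coprime-divisor (coprime-∣ d∣m ∣-refl m⊥a) d∣ab)

coprime-*ˡ : Coprime a m → Coprime b m → Coprime (a * b) m
coprime-*ˡ a⊥m b⊥m = coprime-sym (coprime-*ʳ (coprime-sym a⊥m) (coprime-sym b⊥m))

coprime-+⁻ : Coprime (m + n) m → Coprime n m
coprime-+⁻ c (d∣n , d∣m) = c (∣m∣n⇒∣m+n d∣m d∣n , d∣m)

coprime-^ : Coprime m a → ∀ e → Coprime m (a ^ e)
coprime-^ m⊥a zero    (_ , d∣1) = ∣1⇒≡1 d∣1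
coprime-^ m⊥a (suc e)           = coprime-*ʳ m⊥a (coprime-^ m⊥a e)

prime∤⇒coprime : Prime d → ¬ d ∣ m → Coprime m d
prime∤⇒coprime d-prime d∤m (c∣m , c∣d) =
  [ id , (λ { refl → contradiction c∣m d∤m }) ]′ (prime⇒irreducible d-prime c∣d)

prime≢1 : Prime d → d ≢ 1
prime≢1 d-prime = nonTrivial⇒≢1 {{prime⇒nonTrivial d-prime}}

<-prime⇒coprime : Prime a → Prime b → a < b → Coprime b a
<-prime⇒coprime a-prime b-prime a<b = prime∤⇒coprime a-prime λ a∣b →
  [ prime≢1 a-prime , <⇒≢ a<b ]′ (prime⇒irreducible b-prime a∣b)

∣-≢1⇒¬coprime : d ≢ 1 → d ∣ m → d ∣ n → ¬ Coprime m n
∣-≢1⇒¬coprime d≢1 d∣m d∣n m⊥n = d≢1 (m⊥n (d∣m , d∣n))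

-- Euler's totient as a count.

φ≡count : ∀ m → φ m ≡ count (λ x → coprime? x m) m
φ≡count m = begin
  length (filter C? (map suc (upTo m)))   ≡⟨ cong (length ∘ filter C?) (map-upTo suc m) ⟩
  length (filter C? (applyUpTo suc m))    ≡⟨ length-filter-applyUpTo C? suc m ⟩
  count (C? ∘ suc) m                      ≡⟨ +-cancelˡ-≡ (count C? 1) _ _ rotate ⟩
  count C? m                              ∎
  where
  open ≡-Reasoning
  C? = λ x → coprime? x m
  -- `φ` ranges over 1, ..., `m`, while `count` ranges over 0, ..., `m` - 1. Split 0, ..., `m` once
  -- at the front and once at the end: the endpoints 0 and `m` are congruent modulo `m`, so they
  -- contribute equally.
  rotate : count C? 1 + count (C? ∘ suc) m ≡ count C? 1 + count C? m
  rotate = begin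
    count C? 1 + count (C? ∘ suc) m      ≡⟨ count-+ C? 1 m ⟨
    count C? (1 + m)                     ≡⟨ cong (count C?) (+-comm 1 m) ⟩
    count C? (m + 1)                     ≡⟨ count-+ C? m 1 ⟩
    count C? m + count (C? ∘ (m +_)) 1
      ≡⟨ cong (count C? m +_) (count-cong (C? ∘ (m +_)) C? 1
           (λ _ → coprime-+⁻) (λ _ → coprime-+)) ⟩
    count C? m + count C? 1              ≡⟨ +-comm (count C? m) _ ⟩
    count C? 1 + count C? m              ∎

count-coprime : ∀ m k → count (λ x → coprime? x m) (k * m) ≤ k * φ m
count-coprime m k = ≤-trans
  (count-periodic (λ x → coprime? x m) m (λ _ → coprime-+⁻) k)
  (≤-reflexive (cong (k *_) (sym (φ≡count m))))

count-¬coprime : ∀ m k → count (λ x → ¬? (coprime? x m)) (k * m) ≤ k * (m ∸ φ m)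
count-¬coprime m k = ≤-trans
  (count-periodic (λ x → ¬? (coprime? x m)) m (λ _ ¬c c → ¬c (coprime-+ c)) k)
  (≤-reflexive (cong (k *_)
    (trans (count-¬ (λ x → coprime? x m) m) (cong (m ∸_) (sym (φ≡count m))))))

-- Divisibility in the cyclic group.

module _ (n : ℕ) .{{_ : NonZero n}} where
  open FiniteGroup (C n)

  module _ (d∣n : d ∣ n) where

    ∣⇒∣toℕ-mod : d ∣ a → d ∣ toℕ (a mod n)
    ∣⇒∣toℕ-mod {a} d∣a = subst (d ∣_) (sym (toℕ-fromℕ< (m%n<n a n))) (%-presˡ-∣ d∣a d∣n)

    ∣toℕ-mod⇒∣ : d ∣ toℕ (a mod n) → d ∣ a
    ∣toℕ-mod⇒∣ {a} d∣r = ∣n∣m%n⇒∣m d∣n (subst (d ∣_) (toℕ-fromℕ< (m%n<n a n)) d∣r)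

    ∣-⁻¹ : ∀ x → d ∣ toℕ x → d ∣ toℕ (x ⁻¹)
    ∣-⁻¹ x d∣x = ∣⇒∣toℕ-mod
      (∣m+n∣m⇒∣n (subst (d ∣_) (sym (m+[n∸m]≡n (<⇒≤ (toℕ<n x)))) d∣n) d∣x)

    ∣-· : ∀ k x → d ∣ toℕ x → d ∣ toℕ (k · x)
    ∣-· zero    x d∣x = ∣⇒∣toℕ-mod (d ∣0)
    ∣-· (suc k) x d∣x = ∣⇒∣toℕ-mod (∣m∣n⇒∣m+n d∣x (∣-· k x d∣x))

    -- Since `d` divides `n`, reduction modulo `n` respects divisibility by `d`. The residues
    -- divisible by `d` are thus closed under sums and inverses and contain `⟨ y ⟩` as soon as they
    -- contain `y`.
    ∈⟨⟩⇒∣ : ∀ {x y} → x ∈⟨ y ⟩ → d ∣ toℕ y → d ∣ toℕ x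
    ∈⟨⟩⇒∣ {y = y} (ℤ.+ k      , refl) d∣y = ∣-· k y d∣y
    ∈⟨⟩⇒∣ {y = y} (ℤ.-[1+ k ] , refl) d∣y = ∣-⁻¹ (suc k · y) (∣-· (suc k) y d∣y)

  κ≤ : ∀ S → Separating (𝒫 (C n)) S → κ (𝒫 (C n)) ≤ size S
  κ≤ = proj₂ (proj₂ (vertexConnectivity (𝒫 (C n))))

  -- The bound depends on the factorisation only through these data. `coprime-radical` expresses
  -- that every prime factor of `n` divides `D * P * Q`.
  module _ {k D P Q : ℕ} (n≡kDPQ : n ≡ k * (D * P * Q))
           (P-prime : Prime P) (Q-prime : Prime Q) (D≢1 : D ≢ 1)
           (P⊥D : Coprime P D) (Q⊥D : Coprime Q D) (Q⊥P : Coprime Q P)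
           (coprime-radical : ∀ {y} → Coprime y (D * P * Q) → Coprime y n) where

    private
      instance
        P≢0 : NonZero P
        P≢0 = prime⇒nonZero P-prime
        Q≢0 : NonZero Q
        Q≢0 = prime⇒nonZero Q-prime

      -- The separating set and its two sides.

      Block : ℕ → Set
      Block x = P ∣ x × Q ∣ x × Coprime x D

      Cut : ℕ → Set
      Cut x = Coprime x n
            ⊎ Q ∣ x × Coprime x (D * P)
            ⊎ P ∣ x × Coprime x (D * Q)
            ⊎ P ∣ x × Q ∣ x × ¬ Coprime x D

      cut₁? : ∀ x → Dec (Coprime x n)
      cut₁? x = coprime? x n
      cut₂? : ∀ x → Dec (Q ∣ x × Coprime x (D * P))
      cut₂? x = (Q ∣? x) ×-dec coprime? x (D * P)
      cut₃? : ∀ x → Dec (P ∣ x × Coprime x (D * Q))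
      cut₃? x = (P ∣? x) ×-dec coprime? x (D * Q)
      cut₄? : ∀ x → Dec (P ∣ x × Q ∣ x × ¬ Coprime x D)
      cut₄? x = (P ∣? x) ×-dec (Q ∣? x) ×-dec ¬? (coprime? x D)

      cut? : Decidable Cut
      cut? x = cut₁? x ⊎-dec cut₂? x ⊎-dec cut₃? x ⊎-dec cut₄? x

      S : Subset n
      S = filterᶠ cut? n

      ∈S⁺ : ∀ {x} → Cut (toℕ x) → x ∈ S
      ∈S⁺ = ∈-filterᶠ⁺ cut?

      ∈S⁻ : ∀ {x} → x ∈ S → Cut (toℕ x)
      ∈S⁻ = ∈-filterᶠ⁻ cut?

      DPQ∣n : D * P * Q ∣ n
      DPQ∣n = divides k n≡kDPQ
      DP∣n : D * P ∣ n
      DP∣n = ∣-trans (m∣m*n Q) DPQ∣n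
      D∣n : D ∣ n
      D∣n = ∣-trans (m∣m*n P) DP∣n
      P∣n : P ∣ n
      P∣n = ∣-trans (n∣m*n D) DP∣n
      Q∣n : Q ∣ n
      Q∣n = ∣-trans (n∣m*n (D * P)) DPQ∣n

      PQ : Fin n
      PQ = (P * Q) mod n

      PQ-block : Block (toℕ PQ)
      PQ-block = ∣⇒∣toℕ-mod P∣n (m∣m*n Q) , ∣⇒∣toℕ-mod Q∣n (n∣m*n P) ,
        -- A divisor of `D` divides `n`, so if it divides the residue it divides `P * Q` itself,
        -- which is coprime to `D`.
        λ (d∣r , d∣D) → coprime-*ˡ P⊥D Q⊥D (∣toℕ-mod⇒∣ (∣-trans d∣D D∣n) d∣r , d∣D)

      block⇒¬cut : ∀ {x} → Block x → ¬ Cut x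
      block⇒¬cut (P∣x , Q∣x , x⊥D) (inj₁ c) =
        ∣-≢1⇒¬coprime (prime≢1 P-prime) P∣x P∣n c
      block⇒¬cut (P∣x , Q∣x , x⊥D) (inj₂ (inj₁ (_ , c))) =
        ∣-≢1⇒¬coprime (prime≢1 P-prime) P∣x (n∣m*n D) c
      block⇒¬cut (P∣x , Q∣x , x⊥D) (inj₂ (inj₂ (inj₁ (_ , c)))) =
        ∣-≢1⇒¬coprime (prime≢1 Q-prime) Q∣x (n∣m*n D) c
      block⇒¬cut (P∣x , Q∣x , x⊥D) (inj₂ (inj₂ (inj₂ (_ , _ , ¬x⊥D)))) = ¬x⊥D x⊥D

      D̂ : Fin n
      D̂ = D mod n

      D∣D̂ : D ∣ toℕ D̂
      D∣D̂ = ∣⇒∣toℕ-mod D∣n ∣-refl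

      Q∤D̂ : ¬ Q ∣ toℕ D̂
      Q∤D̂ Q∣D̂ = ∣-≢1⇒¬coprime (prime≢1 Q-prime) ∣-refl (∣toℕ-mod⇒∣ Q∣n Q∣D̂) Q⊥D

      D̂∉S : D̂ ∉ S
      D̂∉S D̂∈S with ∈S⁻ D̂∈S
      ... | inj₁ c                      = ∣-≢1⇒¬coprime D≢1 D∣D̂ D∣n c
      ... | inj₂ (inj₁ (_ , c))         = ∣-≢1⇒¬coprime D≢1 D∣D̂ (m∣m*n P) c
      ... | inj₂ (inj₂ (inj₁ (_ , c)))  = ∣-≢1⇒¬coprime D≢1 D∣D̂ (m∣m*n Q) c
      ... | inj₂ (inj₂ (inj₂ (_ , Q∣D̂ , _))) = Q∤D̂ Q∣D̂

      -- If `y` is coprime to `D`, missing `P`, `Q` or both puts it in one of the first three kinds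
      -- of `Cut`. If `P` and `Q` both divide `y`, sharing a factor with `D` puts it in the fourth.
      ¬cut⇒block : ∀ {y} → ¬ Cut y → Coprime y D ⊎ P ∣ y × Q ∣ y → Block y
      ¬cut⇒block {y} ¬cut (inj₂ (P∣y , Q∣y)) with coprime? y D
      ... | yes y⊥D = P∣y , Q∣y , y⊥D
      ... | no ¬y⊥D = ⊥-elim $ ¬cut (inj₂ (inj₂ (inj₂ (P∣y , Q∣y , ¬y⊥D))))
      ¬cut⇒block {y} ¬cut (inj₁ y⊥D) with P ∣? y | Q ∣? y
      ... | yes P∣y | yes Q∣y = P∣y , Q∣y , y⊥D
      ... | no P∤y  | yes Q∣y = ⊥-elim $ ¬cut
        (inj₂ (inj₁ (Q∣y , coprime-*ʳ y⊥D (prime∤⇒coprime P-prime P∤y))))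
      ... | yes P∣y | no Q∤y  = ⊥-elim $ ¬cut
        (inj₂ (inj₂ (inj₁ (P∣y , coprime-*ʳ y⊥D (prime∤⇒coprime Q-prime Q∤y)))))
      ... | no P∤y  | no Q∤y  = ⊥-elim $ ¬cut
        (inj₁ (coprime-radical (coprime-*ʳ (coprime-*ʳ y⊥D
          (prime∤⇒coprime P-prime P∤y)) (prime∤⇒coprime Q-prime Q∤y))))

      -- Divisibility by divisors of `n` passes from a generator to what it generates. If `y`
      -- generates `x`, a common factor of `y` and `D` would also divide `x`; if `x` generates `y`,
      -- then `P` and `Q` pass on to `y`.
      step : ∀ {x y} → AdjOff (𝒫 (C n)) S x y → Block (toℕ x) → Block (toℕ y)
      step (_ , y∉S , _ , inj₁ x∈⟨y⟩) (_ , _ , x⊥D) =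
        ¬cut⇒block (y∉S ∘ ∈S⁺) (inj₁ λ (d∣y , d∣D) →
          x⊥D (∈⟨⟩⇒∣ (∣-trans d∣D D∣n) x∈⟨y⟩ d∣y , d∣D))
      step (_ , y∉S , _ , inj₂ y∈⟨x⟩) (P∣x , Q∣x , _) =
        ¬cut⇒block (y∉S ∘ ∈S⁺) (inj₂ (∈⟨⟩⇒∣ P∣n y∈⟨x⟩ P∣x , ∈⟨⟩⇒∣ Q∣n y∈⟨x⟩ Q∣x))

      walk : ∀ {x y} → Star (AdjOff (𝒫 (C n)) S) x y → Block (toℕ x) → Block (toℕ y)
      walk []       = id
      walk (s ◅ ss) = walk ss ∘ step s

      S-separating : Separating (𝒫 (C n)) S
      S-separating = inj₁ (PQ , D̂ , block⇒¬cut PQ-block ∘ ∈S⁻ , D̂∉S ,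
        -- A walk from `PQ` to `D̂` would place `D̂` in the block and make it divisible by `Q`.
        λ w → Q∤D̂ (proj₁ (proj₂ (walk w PQ-block))))

      -- The size of the separating set.

      count-cut₁ : count cut₁? n ≡ φ n
      count-cut₁ = sym (φ≡count n)

      -- Dividing by `Q` leaves numbers below `k * (D * P)` that are still coprime to `D * P`; these
      -- fill `k` periods with `φ (D * P)` hits each.
      count-cut₂ : count cut₂? n ≤ k * φ (D * P)
      count-cut₂ = begin
        count cut₂? n
          ≡⟨ cong (count cut₂?) (trans n≡kDPQ (sym (*-assoc k (D * P) Q))) ⟩
        count cut₂? (k * (D * P) * Q)
          ≤⟨ count-multiples Q (λ x → coprime? x (D * P)) (k * (D * P)) ⟩
        count (λ y → coprime? (y * Q) (D * P)) (k * (D * P))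
          ≤⟨ count-mono _ _ (k * (D * P)) (λ y _ → coprime-∣ (m∣m*n Q) ∣-refl) ⟩
        count (λ y → coprime? y (D * P)) (k * (D * P))
          ≤⟨ count-coprime (D * P) k ⟩
        k * φ (D * P) ∎
        where open ≤-Reasoning

      n≡kDQP : n ≡ k * (D * Q) * P
      n≡kDQP = trans n≡kDPQ (rearrange k D P Q)
        where
        rearrange : ∀ k D P Q → k * (D * P * Q) ≡ k * (D * Q) * P
        rearrange = solve-∀

      count-cut₃ : count cut₃? n ≤ k * φ (D * Q)
      count-cut₃ = begin
        count cut₃? n
          ≡⟨ cong (count cut₃?) n≡kDQP ⟩
        count cut₃? (k * (D * Q) * P)
          ≤⟨ count-multiples P (λ x → coprime? x (D * Q)) (k * (D * Q)) ⟩
        count (λ y → coprime? (y * P) (D * Q)) (k * (D * Q))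
          ≤⟨ count-mono _ _ (k * (D * Q)) (λ y _ → coprime-∣ (m∣m*n P) ∣-refl) ⟩
        count (λ y → coprime? y (D * Q)) (k * (D * Q))
          ≤⟨ count-coprime (D * Q) k ⟩
        k * φ (D * Q) ∎
        where open ≤-Reasoning

      -- Dividing by `P` and then by `Q` leaves numbers below `k * D`. As `P` and `Q` are coprime to
      -- `D`, the common factor with `D` survives both divisions.
      count-cut₄ : count cut₄? n ≤ k * (D ∸ φ D)
      count-cut₄ = begin
        count cut₄? n
          ≡⟨ cong (count cut₄?) n≡kDQP ⟩
        count cut₄? (k * (D * Q) * P)
          ≤⟨ count-multiples P (λ x → (Q ∣? x) ×-dec ¬? (coprime? x D)) (k * (D * Q)) ⟩
        count (λ y → (Q ∣? (y * P)) ×-dec ¬? (coprime? (y * P) D)) (k * (D * Q))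
          ≤⟨ count-mono _ _ (k * (D * Q)) (λ y _ → cancel-P y) ⟩
        count (λ y → (Q ∣? y) ×-dec ¬? (coprime? y D)) (k * (D * Q))
          ≡⟨ cong (count _) (sym (*-assoc k D Q)) ⟩
        count (λ y → (Q ∣? y) ×-dec ¬? (coprime? y D)) (k * D * Q)
          ≤⟨ count-multiples Q (λ x → ¬? (coprime? x D)) (k * D) ⟩
        count (λ y → ¬? (coprime? (y * Q) D)) (k * D)
          ≤⟨ count-mono _ _ (k * D) (λ y _ ¬c c → ¬c (coprime-*ˡ c Q⊥D)) ⟩
        count (λ y → ¬? (coprime? y D)) (k * D)
          ≤⟨ count-¬coprime D k ⟩
        k * (D ∸ φ D) ∎
        where
        open ≤-Reasoning
        cancel-P : ∀ y → Q ∣ y * P × ¬ Coprime (y * P) D → Q ∣ y × ¬ Coprime y D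
        cancel-P y (Q∣yP , ¬c) =
          coprime-divisor Q⊥P (subst (Q ∣_) (*-comm y P) Q∣yP) ,
          λ c → ¬c (coprime-*ˡ c P⊥D)

    κ≤φ+k*[φDP+φDQ+[D∸φD]] :
      κ (𝒫 (C n)) ≤ φ n + k * (φ (D * P) + φ (D * Q) + (D ∸ φ D))
    κ≤φ+k*[φDP+φDQ+[D∸φD]] = begin
      κ (𝒫 (C n))
        ≤⟨ κ≤ S S-separating ⟩
      size S
        ≡⟨ size-filterᶠ cut? n ⟩
      count cut? n
        -- Union bound over the four kinds of deleted vertices.
        ≤⟨ count-⊎ cut₁? _ n ⟩
      count cut₁? n + count (λ x → cut₂? x ⊎-dec cut₃? x ⊎-dec cut₄? x) n
        ≤⟨ +-mono-≤ (≤-reflexive count-cut₁) (≤-trans (count-⊎ cut₂? _ n)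
             (+-mono-≤ count-cut₂ (≤-trans (count-⊎ cut₃? _ n)
               (+-mono-≤ count-cut₃ count-cut₄)))) ⟩
      φ n + (k * φ (D * P) + (k * φ (D * Q) + k * (D ∸ φ D)))
        ≡⟨ factor (φ n) k (φ (D * P)) (φ (D * Q)) (D ∸ φ D) ⟩
      φ n + k * (φ (D * P) + φ (D * Q) + (D ∸ φ D)) ∎
      where
      open ≤-Reasoning
      factor : ∀ f k x y z → f + (k * x + (k * y + k * z)) ≡ f + k * (x + y + z)
      factor = solve-∀

-- Products and the given prime factorisation.

∏-∣ : ∀ {f g} k → (∀ i → 1 ≤ i → i ≤ k → f i ∣ g i) → ∏ k f ∣ ∏ k g
∏-∣ zero    f∣g = ∣-refl
∏-∣ (suc k) f∣g = *-pres-∣ (∏-∣ k (λ i 1≤i i≤k → f∣g i 1≤i (m≤n⇒m≤1+n i≤k)))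
                           (f∣g (suc k) z<s ≤-refl)

coprime-∏ : ∀ {f} k → (∀ i → 1 ≤ i → i ≤ k → Coprime m (f i)) → Coprime m (∏ k f)
coprime-∏ zero    m⊥f (_ , d∣1) = ∣1⇒≡1 d∣1
coprime-∏ (suc k) m⊥f = coprime-*ʳ
  (coprime-∏ k (λ i 1≤i i≤k → m⊥f i 1≤i (m≤n⇒m≤1+n i≤k))) (m⊥f (suc k) z<s ≤-refl)

∣∏ : ∀ f k i → 1 ≤ i → i ≤ k → f i ∣ ∏ k f
∣∏ f zero    (suc i) _ ()
∣∏ f (suc k) i 1≤i i≤1+k with m≤n⇒m<n∨m≡n i≤1+k
... | inj₁ i<1+k = ∣-trans (∣∏ f k i 1≤i (s≤s⁻¹ i<1+k)) (m∣m*n (f (suc k)))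
... | inj₂ refl  = n∣m*n (∏ k f)

m∣m^n : ∀ m → 1 ≤ n → m ∣ m ^ n
m∣m^n {suc n} m _ = m∣m*n (m ^ n)

theorem1p1 : (n : ℕ) .{{_ : NonZero n}} (F : PrimePowerFactorisation n) →
    3 ≤ PrimePowerFactorisation.r F →
    κ (𝒫 (C n)) ≤ PrimePowerFactorisation.γ F
theorem1p1 n F@record { r = suc (suc (suc t)) ; p = p ; e = e } (s≤s (s≤s (s≤s z≤n))) = begin
  κ (𝒫 (C n))
    ≤⟨ κ≤φ+k*[φDP+φDQ+[D∸φD]] n {k} n≡k*D*P*Q P-prime Q-prime D≢1 P⊥D Q⊥D Q⊥P coprime-radical ⟩
  φ n + k * (φ (D * P) + φ (D * Q) + (D ∸ φ D))
    ≡⟨ cong (λ q → φ n + q * (φ (D * P) + φ (D * Q) + (D ∸ φ D))) k≡n/DPQ ⟩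
  γ ∎
  where
  open ≤-Reasoning
  open PrimePowerFactorisation F using (p-prime; p-strict; e-positive; n≡∏p^e; ∏p-nonZero; γ)
  -- With `r` matched as `3 + t`, the products in `γ` unfold to `D * P * Q`, `D * P`, `D * Q` and
  -- `D`. At least three primes means that `p 1` occurs in `D`, whence `D≢1`.
  D = ∏ (1 + t) p
  P = p (2 + t)
  Q = p (3 + t)

  DPQ∣n : D * P * Q ∣ n
  DPQ∣n = subst (D * P * Q ∣_) (sym n≡∏p^e)
    (∏-∣ (3 + t) (λ i 1≤i i≤r → m∣m^n (p i) (e-positive i 1≤i i≤r)))

  k : ℕ
  k = quotient DPQ∣n

  n≡k*D*P*Q : n ≡ k * (D * P * Q)
  n≡k*D*P*Q = _∣_.equality DPQ∣n

  k≡n/DPQ : k ≡ _/_ n (D * P * Q) {{∏p-nonZero}}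
  k≡n/DPQ = sym (trans (cong (λ x → _/_ x (D * P * Q) {{∏p-nonZero}}) n≡k*D*P*Q)
                       (m*n/n≡m k (D * P * Q) {{∏p-nonZero}}))

  P-prime : Prime P
  P-prime = p-prime (2 + t) z<s (n≤1+n _)

  Q-prime : Prime Q
  Q-prime = p-prime (3 + t) z<s ≤-refl

  p-coprime : ∀ {i j} → 1 ≤ i → i < j → j ≤ 3 + t → Coprime (p j) (p i)
  p-coprime {i} {j} 1≤i i<j j≤r = <-prime⇒coprime
    (p-prime i 1≤i (≤-trans (<⇒≤ i<j) j≤r)) (p-prime j (≤-trans 1≤i (<⇒≤ i<j)) j≤r)
    (p-strict i j 1≤i i<j j≤r)

  P⊥D : Coprime P D
  P⊥D = coprime-∏ (1 + t) (λ i 1≤i i≤1+t → p-coprime 1≤i (s≤s i≤1+t) (n≤1+n _))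

  Q⊥D : Coprime Q D
  Q⊥D = coprime-∏ (1 + t) (λ i 1≤i i≤1+t → p-coprime 1≤i (s≤s (m≤n⇒m≤1+n i≤1+t)) ≤-refl)

  Q⊥P : Coprime Q P
  Q⊥P = p-coprime z<s ≤-refl ≤-refl

  D≢1 : D ≢ 1
  D≢1 D≡1 = prime≢1 (p-prime 1 z<s z<s) (∣1⇒≡1 (subst (p 1 ∣_) D≡1 (∣∏ p (1 + t) 1 z<s z<s)))

  -- Each `p i` divides `D * P * Q`, so `y` is coprime to every `p i`, hence to its power and to the
  -- product of these powers.
  coprime-radical : ∀ {y} → Coprime y (D * P * Q) → Coprime y n
  coprime-radical y⊥DPQ = subst (Coprime _) (sym n≡∏p^e)
    (coprime-∏ (3 + t) λ i 1≤i i≤r →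
      coprime-^ (coprime-∣ ∣-refl (∣∏ p (3 + t) i 1≤i i≤r) y⊥DPQ) (e i))
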